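{- For all integers $a, b \geq 11$ we have $N(0,2;a)\,N(0,2;b) > N(0,2;a+b)$, and for all integers $a, b \geq 12$ we have $N(1,2;a)\,N(1,2;b) > N(1,2;a+b)$.
   Context: A partition of $n$ is a finite nondecreasing list of positive integers $\lambda = (\lambda_1 \le \dots \le \lambda_k)$ summing to $n$; its rank is $\lambda_k - k$ (largest part minus number of parts). $N(r,2;n)$ denotes the number of partitions of $n$ whose rank is congruent to $r$ modulo $2$. -}

module Defs where

open import Data.Nat using (ℕ; zero; suc; _+_; _∸_; _≤_; _<_; _≤?_; _%_)
open import Data.Nat.Induction using (<-rec)
open import Data.List using (List; []; _∷_; length; sum; filter; concatMap; last)
open import Data.Maybe using (Maybe; just; nothing)
open import Data.Integer as ℤ using (ℤ; +_)
open import Data.Integer.DivMod using (_%ℕ_)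
open import Relation.Nullary.Decidable using (map′)
open import Data.Nat using (_≟_)
open import Relation.Binary.PropositionalEquality using (_≡_)

-- A partition is a nondecreasing list of positive integers
-- (λ₁ ≤ … ≤ λₖ).  `partsFrom fuel m n` lists all nondecreasing lists of
-- integers each ≥ m (with m ≥ 1 supplied) summing to n.  `fuel` bounds the
-- recursion depth; fuel = n suffices since every part is ≥ 1.
partsFrom : ℕ → ℕ → ℕ → List (List ℕ)
partsFrom _        _ zero    = [] ∷ []
partsFrom zero     _ (suc _) = []
partsFrom (suc f)  m (suc n) = concatMap choose (range m (suc n))
  where
    range : ℕ → ℕ → List ℕ
    range lo hi = go (suc hi ∸ lo) lo
      where
        go : ℕ → ℕ → List ℕ
        go zero    _ = []
        go (suc k) i = i ∷ go k (suc i)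
    prepend : ℕ → List (List ℕ) → List (List ℕ)
    prepend p []         = []
    prepend p (l ∷ ls)   = (p ∷ l) ∷ prepend p ls
    choose : ℕ → List (List ℕ)
    choose p = prepend p (partsFrom f p (suc n ∸ p))

partitions : ℕ → List (List ℕ)
partitions n = partsFrom n 1 n

-- largest part of a nondecreasing list (0 for the empty partition)
largestPart : List ℕ → ℕ
largestPart l with last l
... | just x  = x
... | nothing = 0

rank : List ℕ → ℤ
rank l = + largestPart l ℤ.- + length l

N2 : ℕ → ℕ → ℕ
N2 r n = length (filter (λ l → (rank l %ℕ 2) ≟ (r % 2)) (partitions n))

{-# OPTIONS --safe #-}
module Submission where

-- Let p(n) be the number of partitions of n and X₀(n), X₁(n) the numbers of those of
-- even and odd rank. Exchanging two parts 1 for one part 2 flips the parity of the rank,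
-- so the two classes are balanced up to p ≤ 4 X₀, 4 X₁ for n ≥ 5. It therefore suffices
-- that 13 p(a + b) ≤ p(a) p(b) for large a and b. This follows by induction from
-- n p(n) = Σ σ(k) p(n − k): comparing the recurrences for (a + b) p(a + b) and b p(b)
-- term by term leaves only O(b²) p(a) error terms, which are absorbed by a p(a) p(b)
-- because p(b) outgrows b². Taking a = 1 in the same comparison gives
-- p(b + 1) ≤ (6/5) p(b), which settles the case of one small argument, and a table of
-- X₀, X₁ up to 119 settles the case of two small arguments.

open import Defs
open import Data.Bool using (Bool; true; false; not; if_then_else_)
open import Data.Bool.Properties using (not-involutive)
open import Data.Empty using (⊥-elim)
open import Data.Integer as ℤ using (ℤ; -[1+_]; _⊖_)
open import Data.Integer.DivMod using (_%ℕ_)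
import Data.Integer.Properties as ℤ
open import Data.List using (List; []; _∷_; length; filter; last)
open import Data.List.Relation.Unary.All using (All; []; _∷_)
open import Data.Maybe using (just)
open import Data.Nat
open import Data.Nat.DivMod using (m<n⇒m%n≡m; [m+n]%n≡m%n; n%n≡0)
open import Data.Nat.Induction using (<-rec)
open import Data.Nat.Properties
open import Data.Nat.Tactic.RingSolver using (solve-∀)
open import Data.Product using (_×_; _,_; proj₁; proj₂; ∃)
open import Data.Sum using (inj₁; inj₂)
open import Data.Unit using (tt)
open import Relation.Binary.PropositionalEquality
open import Relation.Nullary using (Dec; yes; no; contradiction)
open import Relation.Nullary.Decidable using (True; toWitness; map′; _×-dec_)
open import Relation.Unary using (Decidable)

-- Counting partitions by the parity of the rank

odd : ℕ → Bool
odd zero    = false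
odd (suc n) = not (odd n)

δ : Bool → Bool → ℕ
δ false false = 1
δ false true  = 0
δ true  false = 0
δ true  true  = 1

-- Names for the local functions of partsFrom, solved by unification:
-- `tailParts f m n k i` lists the partitions whose first part is one of the k
-- numbers i, i+1, …, and `consParts f m n k i ls` is `map (i ∷_) ls` followed
-- by `tailParts f m n k (suc i)`.
mutual
  tailParts : ℕ → ℕ → ℕ → ℕ → ℕ → List (List ℕ)
  tailParts = _

  partsFrom-tail : ∀ f m n k → suc (suc n) ∸ m ≡ suc k → partsFrom f m (suc n ∸ m) ≡ [] →
                   partsFrom (suc f) m (suc n) ≡ tailParts f m n k (suc m)
  partsFrom-tail f m n k eq e with suc (suc n) ∸ m
  partsFrom-tail f m n k refl e | .(suc k) with partsFrom f m (suc n ∸ m)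
  -- Abstracting `suc m` leaves the metavariable applied to distinct variables only, so unification
  -- has a unique solution.
  partsFrom-tail f m n k refl refl | .(suc k) | .[] with suc m
  ... | i = refl

mutual
  consParts : ℕ → ℕ → ℕ → ℕ → ℕ → List (List ℕ) → List (List ℕ)
  consParts = _

  tailParts-suc : ∀ f m n k i →
                  tailParts f m n (suc k) i ≡ consParts f m n k i (partsFrom f i (suc n ∸ i))
  tailParts-suc f m n k i with partsFrom f i (suc n ∸ i)
  ... | w = refl

-- `sign m l` is the parity of (largest part + number of parts) of l, where the
-- empty partition counts as having largest part m.
sign : ℕ → List ℕ → Bool
sign m []      = odd m
sign m (p ∷ l) = not (sign p l)

tally : Bool → ℕ → List (List ℕ) → ℕ
tally π m []       = 0
tally π m (l ∷ ls) = δ π (sign m l) + tally π m ls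

δ-not : ∀ π b → δ π (not b) ≡ δ (not π) b
δ-not false false = refl
δ-not false true  = refl
δ-not true  false = refl
δ-not true  true  = refl

-- Prepending `i` adds one part and keeps the largest part, provided an empty remainder counts as
-- having largest part `i`; hence the flip to `not π` and the change of default.
tally-cons : ∀ π m f m' n k i ls →
  tally π m (consParts f m' n k i ls) ≡ tally (not π) i ls + tally π m (tailParts f m' n k (suc i))
tally-cons π m f m' n k i []       = refl
tally-cons π m f m' n k i (l ∷ ls)
  rewrite δ-not π (sign i l) | tally-cons π m f m' n k i ls
  = sym (+-assoc (δ (not π) (sign i l)) _ _)

tally-tail-suc : ∀ π m f m' n k i →
  tally π m (tailParts f m' n (suc k) i) ≡
    tally (not π) i (partsFrom f i (suc n ∸ i)) + tally π m (tailParts f m' n k (suc i))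
tally-tail-suc π m f m' n k i = tally-cons π m f m' n k i (partsFrom f i (suc n ∸ i))

-- The default matters only for the empty partition, and every list in `tailParts` has a first part.
tally-tail-base : ∀ π m₁ m₂ f m₁' m₂' n k i →
  tally π m₁ (tailParts f m₁' n k i) ≡ tally π m₂ (tailParts f m₂' n k i)
tally-tail-base π m₁ m₂ f m₁' m₂' n zero    i = refl
tally-tail-base π m₁ m₂ f m₁' m₂' n (suc k) i
  rewrite tally-tail-suc π m₁ f m₁' n k i | tally-tail-suc π m₂ f m₂' n k i
  = cong₂ _+_ refl (tally-tail-base π m₁ m₂ f m₁' m₂' n k (suc i))

mutual
  tally-fuel : ∀ π m f g n → 1 ≤ m → n ≤ f → n ≤ g →
    tally π m (partsFrom f m n) ≡ tally π m (partsFrom g m n)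
  tally-fuel π m f       g       zero    1≤m _         _         = refl
  tally-fuel π m (suc f) (suc g) (suc n) 1≤m (s≤s n≤f) (s≤s n≤g) =
    tally-tail-fuel π m f g m n (suc (suc n) ∸ m) m 1≤m n≤f n≤g

  tally-tail-fuel : ∀ π m f g m' n k i → 1 ≤ i → n ≤ f → n ≤ g →
    tally π m (tailParts f m' n k i) ≡ tally π m (tailParts g m' n k i)
  tally-tail-fuel π m f g m' n zero    i 1≤i n≤f n≤g = refl
  tally-tail-fuel π m f g m' n (suc k) i@(suc i') 1≤i n≤f n≤g
    rewrite tally-tail-suc π m f m' n k i | tally-tail-suc π m g m' n k i
    = cong₂ _+_ (tally-fuel (not π) i f g (n ∸ i') 1≤i (≤-trans (m∸n≤m n i') n≤f) (≤-trans (m∸n≤m n i') n≤g))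
                (tally-tail-fuel π m f g m' n k (suc i) (s≤s z≤n) n≤f n≤g)

opaque
  -- Opaque, so that goals never unfold into lists of partitions. Apart from `N2≡G`, everything
  -- below rests on the three laws proved here.
  G : Bool → ℕ → ℕ → ℕ
  G π m n = tally π m (partsFrom n m n)

  G-zero : ∀ π m → G π m 0 ≡ δ π (odd m)
  G-zero π m = +-identityʳ _

  G-large : ∀ π m n → 1 ≤ n → n < m → G π m n ≡ 0
  G-large π m (suc n) _ n<m = lem (suc (suc n) ∸ m) (m≤n⇒m∸n≡0 n<m)
    where
    lem : ∀ k → k ≡ 0 → tally π m (tailParts n m n k m) ≡ 0
    lem .0 refl = refl

  -- Either `m` is not a part, or one copy of it is removed, which changes the number of parts by
  -- one.
  G-step : ∀ π m n → 1 ≤ m → m ≤ n → G π m n ≡ G π (suc m) n + G (not π) m (n ∸ m)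
  G-step π m@(suc m') (suc n) 1≤m m≤n = begin
    tally π m (tailParts n m n (suc (suc n) ∸ m) m)
      ≡⟨ cong (λ k → tally π m (tailParts n m n k m)) (+-∸-assoc 1 m≤n) ⟩
    tally π m (tailParts n m n (suc (suc n ∸ m)) m)
      ≡⟨ tally-tail-suc π m n m n (suc n ∸ m) m ⟩
    tally (not π) m (partsFrom n m (suc n ∸ m)) + tally π m (tailParts n m n (suc n ∸ m) (suc m))
      ≡⟨ +-comm (tally (not π) m (partsFrom n m (suc n ∸ m))) _ ⟩
    tally π m (tailParts n m n (suc n ∸ m) (suc m)) + tally (not π) m (partsFrom n m (suc n ∸ m))
      ≡⟨ cong₂ _+_ (tally-tail-base π m (suc m) n m (suc m) n (suc n ∸ m) (suc m))
                   (tally-fuel (not π) m n (suc n ∸ m) (suc n ∸ m) 1≤m (m∸n≤m n m') ≤-refl) ⟩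
    G π (suc m) (suc n) + G (not π) m (suc n ∸ m) ∎
    where open ≡-Reasoning

bit : Bool → ℕ
bit false = 0
bit true  = 1

bit-odd : ∀ n → bit (odd n) ≡ n % 2
bit-odd zero          = refl
bit-odd (suc zero)    = refl
bit-odd (suc (suc n)) = trans (cong bit (not-involutive (odd n))) (bit-odd n)

lastFrom : ℕ → List ℕ → ℕ
lastFrom p []      = p
lastFrom p (q ∷ l) = lastFrom q l

last-∷ : ∀ p l → last (p ∷ l) ≡ just (lastFrom p l)
last-∷ p []      = refl
last-∷ p (q ∷ l) = last-∷ q l

largestPart-∷ : ∀ p l → largestPart (p ∷ l) ≡ lastFrom p l
largestPart-∷ p l with last (p ∷ l) | last-∷ p l
... | .(just (lastFrom p l)) | refl = refl

oddℤ : ℤ → Bool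
oddℤ (ℤ.+ n)    = odd n
oddℤ (-[1+ n ]) = odd (suc n)

%ℕ-oddℤ : ∀ i → i %ℕ 2 ≡ bit (oddℤ i)
%ℕ-oddℤ (ℤ.+ n) = sym (bit-odd n)
%ℕ-oddℤ (-[1+ n ]) with suc n % 2 | bit-odd (suc n)
... | r | eq with odd (suc n)
%ℕ-oddℤ (-[1+ n ]) | .0 | refl | false = refl
%ℕ-oddℤ (-[1+ n ]) | .1 | refl | true = refl

oddℤ-⊖-suc : ∀ a b → oddℤ (a ⊖ suc b) ≡ not (oddℤ (a ⊖ b))
oddℤ-⊖-suc zero    zero    = refl
oddℤ-⊖-suc zero    (suc b) = refl
oddℤ-⊖-suc (suc a) zero    rewrite ℤ.[1+m]⊖[1+n]≡m⊖n a 0 = sym (not-involutive (odd a))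
oddℤ-⊖-suc (suc a) (suc b) rewrite ℤ.[1+m]⊖[1+n]≡m⊖n a b | ℤ.[1+m]⊖[1+n]≡m⊖n a (suc b) = oddℤ-⊖-suc a b

sign-oddℤ : ∀ p l → sign p l ≡ oddℤ (lastFrom p l ⊖ length l)
sign-oddℤ p []      = refl
sign-oddℤ p (q ∷ l) = trans (cong not (sign-oddℤ q l)) (sym (oddℤ-⊖-suc (lastFrom q l) (length l)))

rank-sign : ∀ m p l → rank (p ∷ l) %ℕ 2 ≡ bit (sign m (p ∷ l))
rank-sign m p l = trans (%ℕ-oddℤ (rank (p ∷ l))) (cong bit (begin
  oddℤ (ℤ.+ largestPart (p ∷ l) ℤ.- ℤ.+ suc (length l)) ≡⟨ cong (λ x → oddℤ (ℤ.+ x ℤ.- ℤ.+ suc (length l))) (largestPart-∷ p l) ⟩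
  oddℤ (ℤ.+ lastFrom p l ℤ.- ℤ.+ suc (length l))        ≡⟨ cong oddℤ (ℤ.m-n≡m⊖n (lastFrom p l) (suc (length l))) ⟩
  oddℤ (lastFrom p l ⊖ suc (length l))              ≡⟨ oddℤ-⊖-suc (lastFrom p l) (length l) ⟩
  not (oddℤ (lastFrom p l ⊖ length l))              ≡⟨ cong not (sign-oddℤ p l) ⟨
  sign m (p ∷ l) ∎))
  where open ≡-Reasoning

Nonempty : List ℕ → Set
Nonempty l = l ≢ []

consParts-nonempty : ∀ f m n k i ls → All Nonempty (tailParts f m n k (suc i)) →
                     All Nonempty (consParts f m n k i ls)
consParts-nonempty f m n k i []       h = h
consParts-nonempty f m n k i (l ∷ ls) h = (λ ()) ∷ consParts-nonempty f m n k i ls h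

tailParts-nonempty : ∀ f m n k i → All Nonempty (tailParts f m n k i)
tailParts-nonempty f m n zero    i = []
tailParts-nonempty f m n (suc k) i =
  consParts-nonempty f m n k i (partsFrom f i (suc n ∸ i)) (tailParts-nonempty f m n k (suc i))

bit-injective : ∀ a b → bit a ≡ bit b → a ≡ b
bit-injective false false _ = refl
bit-injective true  true  _ = refl

δ-refl : ∀ b → δ b b ≡ 1
δ-refl false = refl
δ-refl true  = refl

δ-≢ : ∀ a b → a ≢ b → δ a b ≡ 0
δ-≢ false false a≢b = ⊥-elim (a≢b refl)
δ-≢ false true  a≢b = refl
δ-≢ true  false a≢b = refl
δ-≢ true  true  a≢b = ⊥-elim (a≢b refl)

length-filter-tally : {P : List ℕ → Set} (P? : Decidable P) (π : Bool) (m : ℕ) →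
  (∀ p l → P (p ∷ l) → π ≡ sign m (p ∷ l)) → (∀ p l → π ≡ sign m (p ∷ l) → P (p ∷ l)) →
  ∀ ls → All Nonempty ls → length (filter P? ls) ≡ tally π m ls
length-filter-tally P? π m to from []             []       = refl
length-filter-tally P? π m to from ([] ∷ ls)      (h ∷ hs) = ⊥-elim (h refl)
length-filter-tally P? π m to from ((p ∷ l) ∷ ls) (h ∷ hs) with P? (p ∷ l)
... | yes q =
  cong₂ _+_ (sym (trans (cong (λ b → δ b (sign m (p ∷ l))) (to p l q)) (δ-refl (sign m (p ∷ l)))))
            (length-filter-tally P? π m to from ls hs)
... | no ¬q =
  cong₂ _+_ (sym (δ-≢ π (sign m (p ∷ l)) (λ e → ¬q (from p l e))))
            (length-filter-tally P? π m to from ls hs)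

opaque
  unfolding G

  -- Sum and difference of largest part and length have the same parity. At `n = 0` the two sides
  -- differ: the empty partition has rank 0 but sign `odd 1`.
  N2≡G : ∀ r n → 1 ≤ n → N2 r n ≡ G (odd r) 1 n
  N2≡G r (suc n) _ = length-filter-tally (λ l → (rank l %ℕ 2) ≟ (r % 2)) (odd r) 1
    (λ p l eq → bit-injective _ _ (trans (bit-odd r) (trans (sym eq) (rank-sign 1 p l))))
    (λ p l eq → trans (rank-sign 1 p l) (trans (cong bit (sym eq)) (bit-odd r)))
    (partitions (suc n)) (tailParts-nonempty n 1 n (suc n) 1)

-- Tabulation

∑ : ℕ → (ℕ → ℕ) → ℕ
∑ zero    f = 0
∑ (suc n) f = ∑ n f + f n

-- Rows are stored with the largest index first.
Row : Set
Row = List (ℕ × ℕ)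

infixl 9 _!_
_!_ : Row → ℕ → ℕ × ℕ
[]       ! _     = 0 , 0
(v ∷ vs) ! zero  = v
(v ∷ vs) ! suc i = vs ! i

-- The components are crossed because the added part flips the parity, as in `G-step`.
push : ℕ × ℕ → ℕ × ℕ → Row → Row
push (a , b) (c , d) r = (a + d , b + c) ∷ r

-- If the new entry is for `n`, then `r` starts at `n ∸ 1`, so `r ! m` is the entry for `n ∸ suc m`;
-- the default of `_!_` covers `n < suc m`.
extend : ℕ → ℕ × ℕ → Row → Row
extend m v r = push v (r ! m) r

unit : ℕ → ℕ × ℕ
unit m = δ false (odd m) , δ true (odd m)

-- Passes from parts ≥ `2 + m` to parts ≥ `1 + m`. The entry for 0 is replaced, since the class of
-- the empty partition depends on the smallest allowed part.
step : ℕ → Row → Row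
step m []            = []
step m (v ∷ [])      = unit (suc m) ∷ []
step m (v ∷ v' ∷ vs) = extend m v (step m (v' ∷ vs))

descend : ℕ → Row → Row
descend zero    r = r
descend (suc m) r = descend m (step m r)

start : ℕ → ℕ → Row
start m zero          = []
start m (suc zero)    = unit m ∷ []
start m (suc (suc n)) = (0 , 0) ∷ start m (suc n)

table : ℕ → Row
table s = descend s (start (suc s) s)

select : Bool → ℕ × ℕ → ℕ
select false = proj₁
select true  = proj₂

entry : ℕ → Row → Bool → ℕ → ℕ
entry s r π n = select π (r ! (s ∸ suc n))

-- For y = p the last two conditions bound from below the numbers of partitions
-- into parts ≥ 2 and into parts ≥ 3, which are the indicated differences of p.
-- The record keeps M and k from being compared through the unfolded inequalities.
record Growing (y : ℕ → ℕ) (M k : ℕ) : Set where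
  constructor growing
  field
    conditions :
        M * (k * k) ≤ y k
      × (∀ {i} → i < 2 → 2 * M * suc (i + k) + y (i + k) ≤ y (suc (i + k)))
      × (∀ {i} → i < 3 → 4 * M + y (1 + (i + k)) + y (2 + (i + k)) ≤ y (3 + (i + k)) + y (i + k))

growing? : ∀ y M k → Dec (Growing y M k)
growing? y M k = map′ growing Growing.conditions
  ((_ ≤? _) ×-dec allUpTo? (λ i → _ ≤? _) 2 ×-dec allUpTo? (λ i → _ ≤? _) 3)

total : (Bool → ℕ → ℕ) → ℕ → ℕ
total x n = x false n + x true n

-- The second condition, x(n) > 3 (6/5)^n, serves pairs whose other argument is at least 60; the
-- third starts an induction in steps of four. `x` is a parameter so that the conditions can be
-- evaluated on an explicit table and then transported to `G`.
SmallCases : (Bool → ℕ → ℕ) → Bool → ℕ → ℕ → Set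
SmallCases x π k c =
    (∀ {a} → a < k → ∀ {b} → b < k → x π ((a + b) + (c + c)) < x π (a + c) * x π (b + c))
  × (∀ {a} → a < k → 3 * 6 ^ (a + c) < 5 ^ (a + c) * x π (a + c))
  × (∀ {n} → n < 4 → total x (n + 5) ≤ 4 * x π (n + 5))

smallCases? : ∀ x π k c → Dec (SmallCases x π k c)
smallCases? x π k c =
        allUpTo? (λ a → allUpTo? (λ b → _ <? _) k) k
  ×-dec allUpTo? (λ a → _ <? _) k
  ×-dec allUpTo? (λ n → _ ≤? _) 4

-- What has to be computed. A pair (k , c) covers the range c ≤ a < k + c = 60.
-- From 38 on p(n + 1) ≤ (6/5) p(n), and from 17 on p(j) ≥ 13 (6/5)^j, as long as
-- j < 68. The constant 9301 is the exact value of the sum, and 121 = 52 + 69 and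
-- 1554 ≥ (9301 + 20)/6 are what the two inductive steps below require.
Small : (Bool → ℕ → ℕ) → Set
Small x =
    SmallCases x false 49 11
  × SmallCases x true 48 12
  × (∀ {b} → b < 38 → 5 * total x (1 + (b + 38)) ≤ 6 * total x (b + 38))
  × ∑ 38 (λ j → 5 * total x (1 + j) ∸ 6 * total x j) ≤ 9301
  × (∀ {j} → j < 43 → 13 * 6 ^ (j + 17) ≤ total x (j + 17) * 5 ^ (j + 17))
  × Growing (total x) 121 60
  × Growing (total x) 1554 76

small? : ∀ x → Dec (Small x)
small? x =
        smallCases? x false 49 11
  ×-dec smallCases? x true 48 12
  ×-dec allUpTo? (λ b → _ ≤? _) 38
  ×-dec (_ ≤? _)
  ×-dec allUpTo? (λ j → _ ≤? _) 43
  ×-dec growing? (total x) 121 60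
  ×-dec growing? (total x) 1554 76

small-from : ∀ s r → {True (small? (entry s r))} → Small (entry s r)
small-from s r {h} = toWitness h

small : Small (entry 120 (table 120))
small = small-from 120 (table 120) {tt}

-- Correctness of the table

V : ℕ → ℕ → ℕ × ℕ
V m n = G false m n , G true m n

down : (ℕ → ℕ × ℕ) → ℕ → Row
down f zero    = []
down f (suc n) = f n ∷ down f n

down-! : ∀ f n i → i < n → down f n ! i ≡ f (n ∸ suc i)
down-! f (suc n) zero    _         = refl
down-! f (suc n) (suc i) (s≤s i<n) = down-! f n i i<n

down-!-large : ∀ f n i → n ≤ i → down f n ! i ≡ (0 , 0)
down-!-large f zero    i       _         = refl
down-!-large f (suc n) (suc i) (s≤s n≤i) = down-!-large f n i n≤i

V-zero : ∀ m → V m 0 ≡ unit m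
V-zero m = cong₂ _,_ (G-zero false m) (G-zero true m)

V-large : ∀ m n → 1 ≤ n → n < m → V m n ≡ (0 , 0)
V-large m n 1≤n n<m = cong₂ _,_ (G-large false m n 1≤n n<m) (G-large true m n 1≤n n<m)

extend-down : ∀ m n → extend m (V (2 + m) (suc n)) (down (V (suc m)) (suc n)) ≡ down (V (suc m)) (2 + n)
extend-down m n with m ≤? n
... | yes m≤n = trans
  (cong (λ w → push (V (2 + m) (suc n)) w (down (V (suc m)) (suc n))) (down-! (V (suc m)) (suc n) m (s≤s m≤n)))
  (cong (_∷ down (V (suc m)) (suc n))
    (cong₂ _,_ (sym (G-step false (suc m) (suc n) (s≤s z≤n) (s≤s m≤n)))
               (sym (G-step true (suc m) (suc n) (s≤s z≤n) (s≤s m≤n)))))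
... | no m≰n = trans
  (cong₂ (λ v w → push v w (down (V (suc m)) (suc n)))
    (V-large (2 + m) (suc n) (s≤s z≤n) (m<n⇒m<1+n (s≤s (≰⇒> m≰n))))
    (down-!-large (V (suc m)) (suc n) m (≰⇒> m≰n)))
  (cong (_∷ down (V (suc m)) (suc n)) (sym (V-large (suc m) (suc n) (s≤s z≤n) (s≤s (≰⇒> m≰n)))))

step-down : ∀ m n → step m (down (V (2 + m)) n) ≡ down (V (suc m)) n
step-down m zero          = refl
step-down m (suc zero)    = cong (_∷ []) (sym (V-zero (suc m)))
step-down m (suc (suc n)) =
  trans (cong (extend m (V (2 + m) (suc n))) (step-down m (suc n))) (extend-down m n)

descend-down : ∀ m n → descend m (down (V (suc m)) n) ≡ down (V 1) n
descend-down zero    n = refl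
descend-down (suc m) n = trans (cong (descend m) (step-down m n)) (descend-down m n)

start-down : ∀ m n → n ≤ m → start m n ≡ down (V m) n
start-down m zero          _   = refl
start-down m (suc zero)    _   = cong (_∷ []) (sym (V-zero m))
start-down m (suc (suc n)) n<m =
  cong₂ _∷_ (sym (V-large m (suc n) (s≤s z≤n) n<m)) (start-down m (suc n) (<⇒≤ n<m))

select-V : ∀ π m n → select π (V m n) ≡ G π m n
select-V false m n = refl
select-V true  m n = refl

∸-reflect : ∀ {s n} → n < s → s ∸ suc (s ∸ suc n) ≡ n
∸-reflect {s} {n} n<s = trans (cong (s ∸_) (sym (+-∸-assoc 1 n<s))) (m∸[m∸n]≡n (<⇒≤ n<s))

table-down : ∀ s → table s ≡ down (V 1) s
table-down s = trans (cong (descend s) (start-down (suc s) s (n≤1+n s))) (descend-down s s)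

entry-table : ∀ s π n → n < s → entry s (table s) π n ≡ G π 1 n
entry-table s π n n<s = begin
  entry s (table s) π n
    ≡⟨ cong (λ r → entry s r π n) (table-down s) ⟩
  entry s (down (V 1) s) π n
    ≡⟨ cong (select π) (down-! (V 1) s (s ∸ suc n) (∸-monoʳ-< (s≤s z≤n) n<s)) ⟩
  select π (V 1 (s ∸ suc (s ∸ suc n)))
    ≡⟨ cong (λ k → select π (V 1 k)) (∸-reflect n<s) ⟩
  select π (V 1 n)
    ≡⟨ select-V π 1 n ⟩
  G π 1 n ∎
  where open ≡-Reasoning

-- Partitions into parts ≥ `m`, and finite sums

P : ℕ → ℕ → ℕ
P m n = G false m n + G true m n

P-zero : ∀ m → P m 0 ≡ 1
P-zero m = trans (cong₂ _+_ (G-zero false m) (G-zero true m)) (δ-sum (odd m))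
  where
  δ-sum : ∀ b → δ false b + δ true b ≡ 1
  δ-sum false = refl
  δ-sum true  = refl

P-large : ∀ m n → 1 ≤ n → n < m → P m n ≡ 0
P-large m n 1≤n n<m = cong₂ _+_ (G-large false m n 1≤n n<m) (G-large true m n 1≤n n<m)

P-step : ∀ m n → 1 ≤ m → m ≤ n → P m n ≡ P (suc m) n + P m (n ∸ m)
P-step m n 1≤m m≤n = trans (cong₂ _+_ (G-step false m n 1≤m m≤n) (G-step true m n 1≤m m≤n))
  (lem (G false (suc m) n) (G true m (n ∸ m)) (G true (suc m) n) (G false m (n ∸ m)))
  where
  lem : ∀ a b c d → (a + b) + (c + d) ≡ (a + c) + (d + b)
  lem = solve-∀

P-step+ : ∀ m n → 1 ≤ m → P m (m + n) ≡ P (suc m) (m + n) + P m n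
P-step+ m n 1≤m = trans (P-step m (m + n) 1≤m (m≤m+n m n)) (cong (λ k → P (suc m) (m + n) + P m k) (m+n∸m≡n m n))

P-below : ∀ m n → n < m → P m n ≡ P (suc m) n
P-below m zero    _   = trans (P-zero m) (sym (P-zero (suc m)))
P-below m (suc n) n<m = trans (P-large m (suc n) (s≤s z≤n) n<m) (sym (P-large (suc m) (suc n) (s≤s z≤n) (m<n⇒m<1+n n<m)))

∑-cong : ∀ n {f g} → (∀ i → i < n → f i ≡ g i) → ∑ n f ≡ ∑ n g
∑-cong zero    h = refl
∑-cong (suc n) h = cong₂ _+_ (∑-cong n (λ i i<n → h i (m<n⇒m<1+n i<n))) (h n ≤-refl)

∑-mono : ∀ n {f g} → (∀ i → i < n → f i ≤ g i) → ∑ n f ≤ ∑ n g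
∑-mono zero    h = z≤n
∑-mono (suc n) h = +-mono-≤ (∑-mono n (λ i i<n → h i (m<n⇒m<1+n i<n))) (h n ≤-refl)

∑-+ : ∀ n f g → ∑ n (λ i → f i + g i) ≡ ∑ n f + ∑ n g
∑-+ zero    f g = refl
∑-+ (suc n) f g = trans (cong (_+ (f n + g n)) (∑-+ n f g)) (lem (∑ n f) (∑ n g) (f n) (g n))
  where
  lem : ∀ a b c d → (a + b) + (c + d) ≡ (a + c) + (b + d)
  lem = solve-∀

∑-* : ∀ n c f → ∑ n (λ i → c * f i) ≡ c * ∑ n f
∑-* zero    c f = sym (*-zeroʳ c)
∑-* (suc n) c f = trans (cong (_+ c * f n) (∑-* n c f)) (sym (*-distribˡ-+ c (∑ n f) (f n)))

∑-const : ∀ n c → ∑ n (λ _ → c) ≡ n * c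
∑-const zero    c = refl
∑-const (suc n) c = trans (cong (_+ c) (∑-const n c)) (+-comm (n * c) c)

∑-zero : ∀ n {f} → (∀ i → i < n → f i ≡ 0) → ∑ n f ≡ 0
∑-zero n h = trans (∑-cong n h) (trans (∑-const n 0) (*-zeroʳ n))

∑-split : ∀ m n f → ∑ (m + n) f ≡ ∑ m f + ∑ n (λ i → f (m + i))
∑-split m zero    f = trans (cong (λ k → ∑ k f) (+-identityʳ m)) (sym (+-identityʳ _))
∑-split m (suc n) f = trans (cong (λ k → ∑ k f) (+-suc m n))
  (trans (cong (_+ f (m + n)) (∑-split m n f)) (+-assoc (∑ m f) _ _))

∑-head : ∀ n f → (∀ i → f (suc i) ≡ 0) → ∑ (suc n) f ≡ f 0
∑-head n f h = trans (∑-split 1 n f) (trans (cong (f 0 +_) (∑-zero n (λ i _ → h i))) (+-identityʳ (f 0)))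

infixl 7 _⋆_
-- The convolution of τ and F at n, leaving out the term τ 0 * F n.
_⋆_ : (ℕ → ℕ) → (ℕ → ℕ) → ℕ → ℕ
(τ ⋆ F) n = ∑ n (λ j → τ (n ∸ j) * F j)

-- The recurrence n p(n) = Σ σ(k) p(n − k)

-- The weight m * [ m divides k ] for k ≥ 1, where m is the successor of the first argument.
div-weight : ℕ → ℕ → ℕ
div-weight m zero    = 0
div-weight m (suc k) = if (suc k % suc m) ≡ᵇ 0 then suc m else 0

div-weight-below : ∀ m k → k < suc m → div-weight m k ≡ 0
div-weight-below m zero    _   = refl
div-weight-below m (suc k) k<m rewrite m<n⇒m%n≡m k<m = refl

div-weight-+ : ∀ m k → div-weight m (suc k + suc m) ≡ div-weight m (suc k)
div-weight-+ m k = cong (λ r → if r ≡ᵇ 0 then suc m else 0) ([m+n]%n≡m%n (suc k) (suc m))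

div-weight-self : ∀ m → div-weight m (suc m) ≡ suc m
div-weight-self m rewrite n%n≡0 (suc m) {{_}} = refl

div-weight-≤ : ∀ m k → div-weight m k ≤ suc m
div-weight-≤ m zero    = z≤n
div-weight-≤ m (suc k) with (suc k % suc m) ≡ᵇ 0
... | true  = ≤-refl
... | false = z≤n

⋆-+ˡ : ∀ τ υ F n → ((λ k → τ k + υ k) ⋆ F) n ≡ (τ ⋆ F) n + (υ ⋆ F) n
⋆-+ˡ τ υ F n = trans (∑-cong n (λ j _ → *-distribʳ-+ (F j) (τ (n ∸ j)) (υ (n ∸ j))))
  (∑-+ n (λ j → τ (n ∸ j) * F j) (λ j → υ (n ∸ j) * F j))

⋆-congʳ : ∀ τ {F F'} n → (∀ j → j < n → F j ≡ F' j) → (τ ⋆ F) n ≡ (τ ⋆ F') n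
⋆-congʳ τ n h = ∑-cong n (λ j j<n → cong (τ (n ∸ j) *_) (h j j<n))

⋆-split : ∀ τ F m n → (τ ⋆ F) (m + n) ≡
  ∑ m (λ j → τ (m + n ∸ j) * F j) + (τ ⋆ (λ i → F (m + i))) n
⋆-split τ F m n = trans (∑-split m n _)
  (cong₂ _+_ refl (∑-cong n (λ i _ → cong (λ k → τ k * F (m + i)) ([m+n]∸[m+o]≡n∸o m n i))))

div-weight-⋆-below : ∀ m F n → n < suc m → (div-weight m ⋆ F) n ≡ 0
div-weight-⋆-below m F n n<m =
  ∑-zero n (λ j _ → cong (_* F j) (div-weight-below m (n ∸ j) (≤-<-trans (m∸n≤m n j) n<m)))

-- For `j < n` periodicity of the weight applies; of the `suc m` new terms only `j = n` has a
-- distance divisible by `suc m`.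
div-weight-⋆-+ : ∀ m F n → (div-weight m ⋆ F) (n + suc m) ≡ (div-weight m ⋆ F) n + suc m * F n
div-weight-⋆-+ m F n = begin
  (div-weight m ⋆ F) (n + suc m)
    ≡⟨ ⋆-split (div-weight m) F n (suc m) ⟩
  ∑ n (λ j → div-weight m (n + suc m ∸ j) * F j) + ∑ (suc m) (λ i → div-weight m (suc m ∸ i) * F (n + i))
    ≡⟨ cong₂ _+_ (∑-cong n low) (∑-head m _ high) ⟩
  (div-weight m ⋆ F) n + div-weight m (suc m) * F (n + 0)
    ≡⟨ cong₂ (λ a b → (div-weight m ⋆ F) n + a * F b) (div-weight-self m) (+-identityʳ n) ⟩
  (div-weight m ⋆ F) n + suc m * F n ∎
  where
  open ≡-Reasoning
  shift : ∀ k → 0 < k → div-weight m (k + suc m) ≡ div-weight m k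
  shift (suc k) _ = div-weight-+ m k
  low : ∀ j → j < n → div-weight m (n + suc m ∸ j) * F j ≡ div-weight m (n ∸ j) * F j
  low j j<n = cong (_* F j) (trans (cong (div-weight m) (+-∸-comm (suc m) (<⇒≤ j<n))) (shift (n ∸ j) (m<n⇒0<n∸m j<n)))
  high : ∀ i → div-weight m (m ∸ i) * F (n + suc i) ≡ 0
  high i = cong (_* F (n + suc i)) (div-weight-below m (m ∸ i) (s≤s (m∸n≤m m i)))

-- With d = `suc m`, the weight has generating function d q^d / (1 - q^d), and dividing the series
-- of `P (2 + m)` by 1 - q^d gives that of `P (suc m)`.
div-weight-⋆-P : ∀ m n → (div-weight m ⋆ P (2 + m)) (n + suc m) ≡ suc m * P (suc m) n
div-weight-⋆-P m = <-rec _ go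
  where
  open ≡-Reasoning
  go : ∀ n → (∀ {k} → k < n → (div-weight m ⋆ P (2 + m)) (k + suc m) ≡ suc m * P (suc m) k) →
       (div-weight m ⋆ P (2 + m)) (n + suc m) ≡ suc m * P (suc m) n
  go n ih with suc m ≤? n
  ... | no m≰n = trans (div-weight-⋆-+ m (P (2 + m)) n)
    (cong₂ _+_ (div-weight-⋆-below m (P (2 + m)) n (≰⇒> m≰n))
               (cong (suc m *_) (sym (P-below (suc m) n (≰⇒> m≰n)))))
  ... | yes m≤n = begin
    (div-weight m ⋆ P (2 + m)) (n + suc m)
      ≡⟨ div-weight-⋆-+ m (P (2 + m)) n ⟩
    (div-weight m ⋆ P (2 + m)) n + suc m * P (2 + m) n
      ≡⟨ cong (λ k → (div-weight m ⋆ P (2 + m)) k + suc m * P (2 + m) n) (sym (m∸n+n≡m m≤n)) ⟩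
    (div-weight m ⋆ P (2 + m)) (n ∸ suc m + suc m) + suc m * P (2 + m) n
      ≡⟨ cong (_+ suc m * P (2 + m) n) (ih (∸-monoʳ-< (s≤s z≤n) m≤n)) ⟩
    suc m * P (suc m) (n ∸ suc m) + suc m * P (2 + m) n
      ≡⟨ trans (sym (*-distribˡ-+ (suc m) (P (suc m) (n ∸ suc m)) _)) (cong (suc m *_) (+-comm (P (suc m) (n ∸ suc m)) _)) ⟩
    suc m * (P (2 + m) n + P (suc m) (n ∸ suc m))
      ≡⟨ cong (suc m *_) (P-step (suc m) n (s≤s z≤n) m≤n) ⟨
    suc m * P (suc m) n ∎

-- Up to degree `N`, the series of `τ` is q F'/F for the generating function F. The cutoff lets
-- finitely many factors of the partition product suffice.
LogDerivative : (ℕ → ℕ) → (ℕ → ℕ) → ℕ → Set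
LogDerivative F τ N = ∀ n → n ≤ N → n * F n ≡ (τ ⋆ F) n

-- Logarithmic derivatives add under products, and `div-weight m` is that of the factor 1 / (1 -
-- q^d) with d = `suc m`.
logDerivative-step : ∀ N m τ → LogDerivative (P (2 + m)) τ N →
                     LogDerivative (P (suc m)) (λ k → τ k + div-weight m k) N
logDerivative-step N m τ hyp = <-rec _ go
  where
  open ≡-Reasoning
  F F' σ : ℕ → ℕ
  F  = P (suc m)
  F' = P (2 + m)
  σ k = τ k + div-weight m k
  go : ∀ n → (∀ {k} → k < n → k ≤ N → k * F k ≡ (σ ⋆ F) k) → n ≤ N → n * F n ≡ (σ ⋆ F) n
  go n ih n≤N with suc m ≤? n
  ... | no m≰n = begin
    n * F n                           ≡⟨ cong (n *_) (P-below (suc m) n (≰⇒> m≰n)) ⟩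
    n * F' n                          ≡⟨ hyp n n≤N ⟩
    (τ ⋆ F') n                        ≡⟨ +-identityʳ _ ⟨
    (τ ⋆ F') n + 0                    ≡⟨ cong ((τ ⋆ F') n +_) (div-weight-⋆-below m F' n (≰⇒> m≰n)) ⟨
    (τ ⋆ F') n + (div-weight m ⋆ F') n  ≡⟨ ⋆-+ˡ τ (div-weight m) F' n ⟨
    (σ ⋆ F') n                        ≡⟨ ⋆-congʳ σ n (λ j j<n → P-below (suc m) j (<-trans j<n (≰⇒> m≰n))) ⟨
    (σ ⋆ F) n ∎
  ... | yes m≤n with n ∸ suc m | m∸n+n≡m m≤n
  ... | i | refl = begin
    (i + suc m) * F (i + suc m)
      ≡⟨ cong ((i + suc m) *_) Fstep ⟩
    (i + suc m) * (F' (i + suc m) + F i)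
      ≡⟨ lem (i + suc m) i (suc m) (F' (i + suc m)) (F i) refl ⟩
    ((i + suc m) * F' (i + suc m) + suc m * F i) + i * F i
      ≡⟨ cong₂ _+_ (cong₂ _+_ (hyp (i + suc m) n≤N) (sym (div-weight-⋆-P m i)))
           (ih (m<m+n i (s≤s z≤n)) (≤-trans (m≤m+n i (suc m)) n≤N)) ⟩
    ((τ ⋆ F') (i + suc m) + (div-weight m ⋆ F') (i + suc m)) + (σ ⋆ F) i
      ≡⟨ cong (_+ (σ ⋆ F) i) (sym (⋆-+ˡ τ (div-weight m) F' (i + suc m))) ⟩
    (σ ⋆ F') (i + suc m) + (σ ⋆ F) i
      ≡⟨ cong (λ k → (σ ⋆ F') k + (σ ⋆ F) i) (+-comm i (suc m)) ⟩
    (σ ⋆ F') (suc m + i) + (σ ⋆ F) i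
      ≡⟨ cong (_+ (σ ⋆ F) i) (⋆-split σ F' (suc m) i) ⟩
    low F' + (σ ⋆ (λ l → F' (suc m + l))) i + (σ ⋆ F) i
      ≡⟨ +-assoc (low F') _ _ ⟩
    low F' + ((σ ⋆ (λ l → F' (suc m + l))) i + (σ ⋆ F) i)
      -- Below `suc m` the functions `F'` and `F` agree; above it `F' (suc m + l) + F l` recombines
      -- to `F (suc m + l)`.
      ≡⟨ cong₂ _+_ (∑-cong (suc m) (λ j j<m → cong (σ (suc m + i ∸ j) *_) (sym (P-below (suc m) j j<m))))
           (trans (sym (∑-+ i _ _)) (∑-cong i λ l _ →
             trans (sym (*-distribˡ-+ (σ (i ∸ l)) (F' (suc m + l)) (F l)))
                   (cong (σ (i ∸ l) *_) (sym (P-step+ (suc m) l (s≤s z≤n)))))) ⟩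
    low F + (σ ⋆ (λ l → F (suc m + l))) i
      ≡⟨ ⋆-split σ F (suc m) i ⟨
    (σ ⋆ F) (suc m + i)
      ≡⟨ cong (σ ⋆ F) (+-comm (suc m) i) ⟩
    (σ ⋆ F) (i + suc m) ∎
    where
    low : (ℕ → ℕ) → ℕ
    low H = ∑ (suc m) (λ j → σ (suc m + i ∸ j) * H j)
    Fstep : F (i + suc m) ≡ F' (i + suc m) + F i
    Fstep = subst (λ k → F k ≡ F' k + F i) (+-comm (suc m) i) (P-step+ (suc m) i (s≤s z≤n))
    lem : ∀ n i m a b → n ≡ i + m → n * (a + b) ≡ (n * a + m * b) + i * b
    lem n i m a b refl = lem' i m a b
      where
      lem' : ∀ i m a b → (i + m) * (a + b) ≡ ((i + m) * a + m * b) + i * b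
      lem' = solve-∀

-- The weight built up is the sum of the divisors d of `k` with m ≤ d ≤ N: at most `suc k ∸ m` of
-- them, each at most `k`. Only this bound is kept.
Weights : ℕ → ℕ → Set
Weights N m = ∃ λ τ → (∀ k → τ k ≤ k * (suc k ∸ m)) × LogDerivative (P m) τ N

weights-start : ∀ N → Weights N (suc N)
weights-start N = (λ _ → 0) , (λ _ → z≤n) , λ where
  zero    _   → refl
  (suc n) n≤N → trans (cong (suc n *_) (P-large (suc N) (suc n) (s≤s z≤n) (s≤s n≤N)))
                      (trans (*-zeroʳ (suc n)) (sym (∑-zero (suc n) (λ _ _ → refl))))

weights-step : ∀ N m → Weights N (2 + m) → Weights N (suc m)
weights-step N m (τ , τ≤ , ld) = (λ k → τ k + div-weight m k) , bound , logDerivative-step N m τ ld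
  where
  bound : ∀ k → τ k + div-weight m k ≤ k * (k ∸ m)
  bound k with suc m ≤? k
  ... | no m≰k = subst (_≤ k * (k ∸ m))
      (trans (sym (+-identityʳ (τ k))) (cong (τ k +_) (sym (div-weight-below m k (≰⇒> m≰k)))))
      (≤-trans (τ≤ k) (*-monoʳ-≤ k (∸-monoʳ-≤ k (n≤1+n m))))
  ... | yes m≤k = begin
    τ k + div-weight m k       ≤⟨ +-mono-≤ (τ≤ k) (≤-trans (div-weight-≤ m k) m≤k) ⟩
    k * (k ∸ suc m) + k        ≡⟨ +-comm _ k ⟩
    k + k * (k ∸ suc m)        ≡⟨ *-suc k (k ∸ suc m) ⟨
    k * suc (k ∸ suc m)        ≡⟨ cong (k *_) (+-∸-assoc 1 m≤k) ⟨
    k * (k ∸ m) ∎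
    where open ≤-Reasoning

weights-descend : ∀ N m → Weights N (suc m) → Weights N 1
weights-descend N zero    w = w
weights-descend N (suc m) w = weights-descend N m (weights-step N m w)

weights : ∀ N → ∃ λ σ → (∀ k → σ k ≤ k * k) × LogDerivative (P 1) σ N
weights N = weights-descend N N (weights-start N)

-- Transfer of the computed conditions from the table to `G`

module Agree {s : ℕ} {x x' : Bool → ℕ → ℕ} (x≡ : ∀ π n → n < s → x π n ≡ x' π n) where

  total-≡ : ∀ n → n < s → total x n ≡ total x' n
  total-≡ n n<s = cong₂ _+_ (x≡ false n n<s) (x≡ true n n<s)

  bound : ∀ {a} k c → a < k → {True (k + c ≤? s)} → a + c < s
  bound k c a<k {h} = ≤-trans (+-monoˡ-≤ c a<k) (toWitness h)

  growing-≡ : ∀ {M} k → {True (6 + k ≤? s)} → Growing (total x) M k → Growing (total x') M k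
  growing-≡ {M} k {h} (growing (g₀ , g₁ , g₂)) = growing
    ( subst (M * (k * k) ≤_) (total-≡ k (≤-trans (m≤n+m (suc k) 5) (toWitness h))) g₀
    , (λ {i} i<2 → subst₂ _≤_ (cong (2 * M * suc (i + k) +_) (at 0 i i<2)) (at 1 i i<2) (g₁ i<2))
    , (λ {i} i<3 → subst₂ _≤_
        (cong₂ _+_ (cong (4 * M +_) (at 1 i i<3)) (at 2 i i<3))
        (cong₂ _+_ (at 3 i i<3) (at 0 i i<3)) (g₂ i<3)) )
    where
    at : ∀ d i {e} → i < e → {True (d + e ≤? 6)} → total x (d + (i + k)) ≡ total x' (d + (i + k))
    at d i {e} i<e {d+e≤6} = total-≡ (d + (i + k)) (≤-trans
      (subst (_≤ 6 + k) (lem d i k) (+-monoˡ-≤ k (≤-trans (+-monoʳ-≤ d i<e) (toWitness d+e≤6)))) (toWitness h))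
      where
      lem : ∀ d i k → d + suc i + k ≡ suc (d + (i + k))
      lem = solve-∀

  smallCases-≡ : ∀ {π} k c → {True ((k + k) + (c + c) ≤? s)} → {True (k + c ≤? s)} → {True (9 ≤? s)} →
                 SmallCases x π k c → SmallCases x' π k c
  smallCases-≡ {π} k c {h₁} {h₂} {h₃} (s₁ , s₂ , s₃) =
      (λ {a} a<k {b} b<k → subst₂ _<_
        (x≡ π (a + b + (c + c)) (bound (k + k) (c + c) (+-mono-<-≤ a<k (<⇒≤ b<k)) {h₁}))
        (cong₂ _*_ (x≡ π (a + c) (bound k c a<k {h₂})) (x≡ π (b + c) (bound k c b<k {h₂})))
        (s₁ a<k b<k))
    , (λ {a} a<k → subst (λ v → 3 * 6 ^ (a + c) < 5 ^ (a + c) * v) (x≡ π (a + c) (bound k c a<k {h₂})) (s₂ a<k))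
    , (λ {n} n<4 → subst₂ _≤_ (total-≡ (n + 5) (bound 4 5 n<4 {h₃})) (cong (4 *_) (x≡ π (n + 5) (bound 4 5 n<4 {h₃}))) (s₃ n<4))

-- Table and `G` agree only pointwise and below 120 = 60 + 60, so each condition is rewritten at the
-- indices it mentions.
small-≡ : ∀ {x x'} → (∀ π n → n < 120 → x π n ≡ x' π n) → Small x → Small x'
small-≡ {x} {x'} x≡ (s₁ , s₂ , s₃ , s₄ , s₅ , s₆ , s₇) =
    smallCases-≡ {false} 49 11 s₁
  , smallCases-≡ {true} 48 12 s₂
  , (λ {b} b<38 → subst₂ _≤_ (cong (5 *_) (total-≡ (suc b + 38) (bound 39 38 (s≤s b<38))))
                             (cong (6 *_) (total-≡ (b + 38) (bound 38 38 b<38))) (s₃ b<38))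
  , subst (_≤ 9301) (∑-cong 38 (λ j j<38 → cong₂ (λ v w → 5 * v ∸ 6 * w)
      (total-≡ (suc j) (≤-trans (s≤s j<38) (m≤m+n 39 81))) (total-≡ j (≤-trans j<38 (m≤m+n 38 82))))) s₄
  , (λ {j} j<43 → subst (λ v → 13 * 6 ^ (j + 17) ≤ v * 5 ^ (j + 17)) (total-≡ (j + 17) (bound 43 17 j<43)) (s₅ j<43))
  , growing-≡ {121} 60 s₆
  , growing-≡ {1554} 76 s₇
  where open Agree {120} {x} {x'} x≡

X : Bool → ℕ → ℕ
X π n = G π 1 n

small-G : Small X
small-G = small-≡ {entry 120 (table 120)} {X} (entry-table 120) small

small-even : SmallCases X false 49 11
small-even = small-G .proj₁

small-odd : SmallCases X true 48 12
small-odd = small-G .proj₂ .proj₁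

small-ratio : ∀ {b} → b < 38 → 5 * P 1 (1 + (b + 38)) ≤ 6 * P 1 (b + 38)
small-ratio = small-G .proj₂ .proj₂ .proj₁

small-∑ : ∑ 38 (λ j → 5 * P 1 (1 + j) ∸ 6 * P 1 j) ≤ 9301
small-∑ = small-G .proj₂ .proj₂ .proj₂ .proj₁

small-power : ∀ {j} → j < 43 → 13 * 6 ^ (j + 17) ≤ P 1 (j + 17) * 5 ^ (j + 17)
small-power = small-G .proj₂ .proj₂ .proj₂ .proj₂ .proj₁

growing-60 : Growing (P 1) 121 60
growing-60 = small-G .proj₂ .proj₂ .proj₂ .proj₂ .proj₂ .proj₁

growing-76 : Growing (P 1) 1554 76
growing-76 = small-G .proj₂ .proj₂ .proj₂ .proj₂ .proj₂ .proj₂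

-- Growth of p and balance of the two classes

p : ℕ → ℕ
p = P 1

p-suc : ∀ n → p (suc n) ≡ P 2 (suc n) + p n
p-suc n = P-step+ 1 n ≤-refl

p-mono : ∀ {m n} → m ≤ n → p m ≤ p n
p-mono {m} {n} m≤n = go (≤⇒≤′ m≤n)
  where
  go : ∀ {n} → m ≤′ n → p m ≤ p n
  go ≤′-refl         = ≤-refl
  go (≤′-step {n} h) = ≤-trans (go h) (subst (p n ≤_) (sym (p-suc n)) (m≤n+m (p n) (P 2 (suc n))))

P-antitone : ∀ m n → 1 ≤ m → P (suc m) n ≤ P m n
P-antitone m n 1≤m with m ≤? n
... | yes m≤n = subst (P (suc m) n ≤_) (sym (P-step m n 1≤m m≤n)) (m≤m+n _ _)
... | no  m≰n = ≤-reflexive (sym (P-below m n (≰⇒> m≰n)))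

-- Combinatorially, the smallest part is lowered by one. The proof splits off the part `m` and
-- inducts on a bound `d` for the distance from `m` to beyond `n`.
P-shift : ∀ m n → 1 ≤ m → P (suc m) (suc n) ≤ P m n
P-shift m n 1≤m = go (suc n) m 1≤m (m≤m+n (suc n) m)
  where
  go : ∀ d m → 1 ≤ m → n < d + m → P (suc m) (suc n) ≤ P m n
  go d m 1≤m n<d+m with m ≤? n
  ... | no m≰n = subst (_≤ P m n) (sym (P-large (suc m) (suc n) (s≤s z≤n) (s≤s (≰⇒> m≰n)))) z≤n
  go zero    m 1≤m n<m   | yes m≤n = contradiction n<m (≤⇒≯ m≤n)
  go (suc d) m 1≤m n<d+m | yes m≤n = begin
    P (suc m) (suc n)                     ≡⟨ P-step (suc m) (suc n) (s≤s z≤n) (s≤s m≤n) ⟩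
    P (2 + m) (suc n) + P (suc m) (n ∸ m) ≤⟨ +-mono-≤ (go d (suc m) (s≤s z≤n) (subst (n <_) (sym (+-suc d m)) n<d+m))
                                                      (P-antitone m (n ∸ m) 1≤m) ⟩
    P (suc m) n + P m (n ∸ m)             ≡⟨ P-step m n 1≤m m≤n ⟨
    P m n ∎
    where open ≤-Reasoning

P2-fib : ∀ n → P 2 (2 + n) ≤ P 2 (suc n) + P 2 n
P2-fib n = subst (_≤ P 2 (suc n) + P 2 n) (sym (P-step+ 2 n (s≤s z≤n)))
  (+-monoˡ-≤ (P 2 n) (P-shift 2 (suc n) (s≤s z≤n)))

P-split : ∀ π m n → P m n ≡ G π m n + G (not π) m n
P-split false m n = refl
P-split true  m n = +-comm (G false m n) (G true m n)

G-step+ : ∀ π m n → 1 ≤ m → G π m (m + n) ≡ G π (suc m) (m + n) + G (not π) m n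
G-step+ π m n 1≤m = trans (G-step π m (m + n) 1≤m (m≤m+n m n))
  (cong (λ k → G π (suc m) (m + n) + G (not π) m k) (m+n∸m≡n m n))

-- Trading 1 + 1 for 2 changes the sign, which makes both classes gain equally.
G-gain : ∀ π k → P 2 (2 + k) + P 2 (1 + k) + G π 1 k ≤ G π 1 (4 + k)
G-gain π k = begin
  P 2 (2 + k) + P 2 (1 + k) + G π 1 k
    ≡⟨ cong₂ (λ v w → v + w + G π 1 k) (P-split π 2 (2 + k)) (P-split π 2 (1 + k)) ⟩
  (G π 2 (2 + k) + G π' 2 (2 + k)) + (G π 2 (1 + k) + G π' 2 (1 + k)) + G π 1 k
    ≡⟨ lem (G π 2 (2 + k)) (G π' 2 (2 + k)) (G π 2 (1 + k)) (G π' 2 (1 + k)) (G π 1 k) ⟩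
  G π' 2 (2 + k) + (G π 2 (1 + k) + (G π 2 (2 + k) + (G π' 2 (1 + k) + G π 1 k)))
    ≤⟨ +-mono-≤ (two π (2 + k)) (+-monoˡ-≤ _ (subst (λ b → G b 2 (1 + k) ≤ G π' 2 (3 + k)) (not-involutive π) (two π' (1 + k)))) ⟩
  G π 2 (4 + k) + (G π' 2 (3 + k) + (G π 2 (2 + k) + (G π' 2 (1 + k) + G π 1 k)))
    ≡⟨ cong (λ v → G π 2 (4 + k) + (G π' 2 (3 + k) + (G π 2 (2 + k) + v))) (one' k) ⟨
  G π 2 (4 + k) + (G π' 2 (3 + k) + (G π 2 (2 + k) + G π' 1 (1 + k)))
    ≡⟨ cong (λ v → G π 2 (4 + k) + (G π' 2 (3 + k) + v)) (one (1 + k)) ⟨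
  G π 2 (4 + k) + (G π' 2 (3 + k) + G π 1 (2 + k))
    ≡⟨ cong (G π 2 (4 + k) +_) (one' (2 + k)) ⟨
  G π 2 (4 + k) + G π' 1 (3 + k)
    ≡⟨ one (3 + k) ⟨
  G π 1 (4 + k) ∎
  where
  open ≤-Reasoning
  π' = not π
  one : ∀ n → G π 1 (1 + n) ≡ G π 2 (1 + n) + G π' 1 n
  one n = G-step+ π 1 n ≤-refl
  one' : ∀ n → G π' 1 (1 + n) ≡ G π' 2 (1 + n) + G π 1 n
  one' n = subst (λ b → G π' 1 (1 + n) ≡ G π' 2 (1 + n) + G b 1 n) (not-involutive π) (G-step+ π' 1 n ≤-refl)
  two : ∀ b n → G (not b) 2 n ≤ G b 2 (2 + n)
  two b n = subst (G (not b) 2 n ≤_) (sym (G-step+ b 2 n (s≤s z≤n))) (m≤n+m _ _)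
  lem : ∀ a b c d e → (a + b) + (c + d) + e ≡ b + (c + (a + (d + e)))
  lem = solve-∀

-- Writing a, b, c, d for `P 2` at 4 + k, ..., 1 + k, `P2-fib` gives b ≤ c + d and a ≤ 2c + d. So
-- `p` gains at most 4c + 3d, while `G-gain` gives each class at least c + d.
quarter-step : ∀ π k → p k ≤ 4 * G π 1 k → p (4 + k) ≤ 4 * G π 1 (4 + k)
quarter-step π k ih = begin
  p (4 + k)
    ≡⟨ trans (p-suc (3 + k)) (cong (P 2 (4 + k) +_) (trans (p-suc (2 + k)) (cong (P 2 (3 + k) +_)
        (trans (p-suc (1 + k)) (cong (P 2 (2 + k) +_) (p-suc k)))))) ⟩
  P 2 (4 + k) + (P 2 (3 + k) + (P 2 (2 + k) + (P 2 (1 + k) + p k)))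
    ≤⟨ arith (P 2 (4 + k)) (P 2 (3 + k)) (P 2 (2 + k)) (P 2 (1 + k)) (p k) (G π 1 k) (P2-fib (2 + k)) (P2-fib (1 + k)) ih ⟩
  4 * (P 2 (2 + k) + P 2 (1 + k) + G π 1 k)
    ≤⟨ *-monoʳ-≤ 4 (G-gain π k) ⟩
  4 * G π 1 (4 + k) ∎
  where
  open ≤-Reasoning
  arith : ∀ a b c d e g → a ≤ b + c → b ≤ c + d → e ≤ 4 * g → a + (b + (c + (d + e))) ≤ 4 * (c + d + g)
  arith a b c d e g h₁ h₂ h₃ = begin
    a + (b + (c + (d + e)))
      ≤⟨ +-monoˡ-≤ _ (≤-trans h₁ (+-monoˡ-≤ c h₂)) ⟩
    c + d + c + (b + (c + (d + e)))
      ≤⟨ +-monoʳ-≤ (c + d + c) (+-mono-≤ h₂ (+-monoʳ-≤ c (+-monoʳ-≤ d h₃))) ⟩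
    c + d + c + (c + d + (c + (d + 4 * g)))
      ≤⟨ m≤m+n _ d ⟩
    c + d + c + (c + d + (c + (d + 4 * g))) + d
      ≡⟨ lem c d g ⟩
    4 * (c + d + g) ∎
    where
    lem : ∀ c d g → c + d + c + (c + d + (c + (d + 4 * g))) + d ≡ 4 * (c + d + g)
    lem = solve-∀

quarter : ∀ π → (∀ {n} → n < 4 → p (n + 5) ≤ 4 * G π 1 (n + 5)) → ∀ n → p (n + 5) ≤ 4 * G π 1 (n + 5)
quarter π base 0 = base (s≤s z≤n)
quarter π base 1 = base (s≤s (s≤s z≤n))
quarter π base 2 = base (s≤s (s≤s (s≤s z≤n)))
quarter π base 3 = base (s≤s (s≤s (s≤s (s≤s z≤n))))
quarter π base (suc (suc (suc (suc n)))) = quarter-step π (n + 5) (quarter π base n)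

-- A double summation. Adding a part 3 preserves `P 3 ≥ 4 * M` in steps of three; hence `P 2` gains
-- `4 * M` every two steps, and `p` gains 2M(n + 1) ≥ M((n + 1)² - n²) in each step.
growth : ∀ M k → Growing p M k → ∀ i → M * ((i + k) * (i + k)) ≤ p (i + k)
growth M k (growing (g₀ , g₁ , g₂)) = third
  where
  open ≤-Reasoning
  P3-base : ∀ {i} → i < 3 → 4 * M ≤ P 3 (3 + (i + k))
  P3-base {i} i<3 = arith (4 * M) (P 2 (1 + n)) (p n) (p (2 + n)) (P 3 (3 + n)) (subst₂ _≤_
    (cong (λ v → 4 * M + v + p (2 + n)) (p-suc n))
    (cong (_+ p n) (trans (p-suc (2 + n)) (cong (_+ p (2 + n)) (P-step+ 2 (1 + n) (s≤s z≤n)))))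
    (g₂ i<3))
    where
    n = i + k
    arith : ∀ m u q r t → m + (u + q) + r ≤ (t + u) + r + q → m ≤ t
    arith m u q r t h = +-cancelʳ-≤ (u + q + r) m t (subst₂ _≤_ (lem₁ m u q r) (lem₂ t u q r) h)
      where
      lem₁ : ∀ m u q r → m + (u + q) + r ≡ m + (u + q + r)
      lem₁ = solve-∀
      lem₂ : ∀ t u q r → (t + u) + r + q ≡ t + (u + q + r)
      lem₂ = solve-∀
  first : ∀ i → 4 * M ≤ P 3 (3 + (i + k))
  first 0 = P3-base (s≤s z≤n)
  first 1 = P3-base (s≤s (s≤s z≤n))
  first 2 = P3-base (s≤s (s≤s (s≤s z≤n)))
  first (suc (suc (suc i))) = ≤-trans (first i)
    (subst (P 3 (3 + (i + k)) ≤_) (sym (P-step+ 3 (3 + (i + k)) (s≤s z≤n))) (m≤n+m _ (P 4 (6 + (i + k)))))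
  P2-base : ∀ {i} → i < 2 → 2 * M * suc (i + k) ≤ P 2 (suc (i + k))
  P2-base {i} i<2 = +-cancelʳ-≤ (p (i + k)) _ _
    (subst (2 * M * suc (i + k) + p (i + k) ≤_) (p-suc (i + k)) (g₁ i<2))
  second : ∀ i → 2 * M * suc (i + k) ≤ P 2 (suc (i + k))
  second 0 = P2-base (s≤s z≤n)
  second 1 = P2-base (s≤s (s≤s z≤n))
  second (suc (suc i)) = begin
    2 * M * (3 + (i + k))                   ≡⟨ lem M (i + k) ⟩
    4 * M + 2 * M * suc (i + k)             ≤⟨ +-mono-≤ (first i) (second i) ⟩
    P 3 (3 + (i + k)) + P 2 (suc (i + k))   ≡⟨ P-step+ 2 (suc (i + k)) (s≤s z≤n) ⟨
    P 2 (3 + (i + k)) ∎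
    where
    lem : ∀ M n → 2 * M * (3 + n) ≡ 4 * M + 2 * M * (1 + n)
    lem = solve-∀
  third : ∀ i → M * ((i + k) * (i + k)) ≤ p (i + k)
  third zero    = g₀
  third (suc i) = begin
    M * (suc (i + k) * suc (i + k))                     ≤⟨ m≤m+n _ M ⟩
    M * (suc (i + k) * suc (i + k)) + M                 ≡⟨ lem M (i + k) ⟩
    2 * M * suc (i + k) + M * ((i + k) * (i + k))       ≤⟨ +-mono-≤ (second i) (third i) ⟩
    P 2 (suc (i + k)) + p (i + k)                       ≡⟨ p-suc (i + k) ⟨
    p (suc (i + k)) ∎
    where
    lem : ∀ M n → M * ((1 + n) * (1 + n)) + M ≡ 2 * M * (1 + n) + M * (n * n)
    lem = solve-∀

-- Compare (a + b) p(a + b) = Σ σ(a + b − j) p(j) with b p(b) = Σ σ(b − j) p(j) term by term.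
comparison : ∀ a b U V → 0 < a + b →
  U * ((a + b) * (a + b) * ∑ a p) + b * b * ∑ b (λ j → U * p (a + j) ∸ V * p j) ≤ V * (a * p b) →
  U * p (a + b) ≤ V * p b
comparison a b U V 0<a+b hyp with weights (a + b)
... | σ , σ≤ , ld = *-cancelˡ-≤ (a + b) {{>-nonZero 0<a+b}} (begin
  (a + b) * (U * p (a + b))
    ≡⟨ exchange (a + b) U (p (a + b)) ⟩
  U * ((a + b) * p (a + b))
    ≡⟨ cong (U *_) (trans (ld (a + b) ≤-refl) (⋆-split σ p a b)) ⟩
  U * (∑ a (λ j → σ (a + b ∸ j) * p j) + ∑ b (λ j → σ (b ∸ j) * p (a + j)))
    ≡⟨ *-distribˡ-+ U (∑ a (λ j → σ (a + b ∸ j) * p j)) _ ⟩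
  U * ∑ a (λ j → σ (a + b ∸ j) * p j) + U * ∑ b (λ j → σ (b ∸ j) * p (a + j))
    ≤⟨ +-mono-≤ (*-monoʳ-≤ U low) high ⟩
  U * ((a + b) * (a + b) * ∑ a p) + (V * (b * p b) + b * b * ∑ b e)
    ≡⟨ shuffle (U * ((a + b) * (a + b) * ∑ a p)) (V * (b * p b)) (b * b * ∑ b e) ⟩
  V * (b * p b) + (U * ((a + b) * (a + b) * ∑ a p) + b * b * ∑ b e)
    ≤⟨ +-monoʳ-≤ (V * (b * p b)) hyp ⟩
  V * (b * p b) + V * (a * p b)
    ≡⟨ collect V a b (p b) ⟩
  (a + b) * (V * p b) ∎)
  where
  open ≤-Reasoning
  -- The excess is zero wherever U p(a + j) ≤ V p(j), so an induction hypothesis leaves only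
  -- boundedly many nonzero terms.
  e : ℕ → ℕ
  e j = U * p (a + j) ∸ V * p j
  exchange : ∀ x y z → x * (y * z) ≡ y * (x * z)
  exchange = solve-∀
  shuffle : ∀ x y z → x + (y + z) ≡ y + (x + z)
  shuffle = solve-∀
  collect : ∀ v a b q → v * (b * q) + v * (a * q) ≡ (a + b) * (v * q)
  collect = solve-∀
  σ-bound : ∀ n j → σ (n ∸ j) ≤ n * n
  σ-bound n j = ≤-trans (σ≤ (n ∸ j)) (*-mono-≤ (m∸n≤m n j) (m∸n≤m n j))
  low : ∑ a (λ j → σ (a + b ∸ j) * p j) ≤ (a + b) * (a + b) * ∑ a p
  low = ≤-trans (∑-mono a (λ j _ → *-monoˡ-≤ (p j) (σ-bound (a + b) j))) (≤-reflexive (∑-* a ((a + b) * (a + b)) p))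
  term : ∀ j → U * (σ (b ∸ j) * p (a + j)) ≤ V * (σ (b ∸ j) * p j) + b * b * e j
  term j = begin
    U * (σ (b ∸ j) * p (a + j))                  ≡⟨ exchange U (σ (b ∸ j)) (p (a + j)) ⟩
    σ (b ∸ j) * (U * p (a + j))                  ≤⟨ *-monoʳ-≤ (σ (b ∸ j)) (m≤n+m∸n (U * p (a + j)) (V * p j)) ⟩
    σ (b ∸ j) * (V * p j + e j)                  ≡⟨ *-distribˡ-+ (σ (b ∸ j)) (V * p j) (e j) ⟩
    σ (b ∸ j) * (V * p j) + σ (b ∸ j) * e j      ≤⟨ +-mono-≤ (≤-reflexive (exchange (σ (b ∸ j)) V (p j))) (*-monoˡ-≤ (e j) (σ-bound b j)) ⟩
    V * (σ (b ∸ j) * p j) + b * b * e j ∎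
  high : U * ∑ b (λ j → σ (b ∸ j) * p (a + j)) ≤ V * (b * p b) + b * b * ∑ b e
  high = begin
    U * ∑ b (λ j → σ (b ∸ j) * p (a + j))
      ≡⟨ ∑-* b U _ ⟨
    ∑ b (λ j → U * (σ (b ∸ j) * p (a + j)))
      ≤⟨ ∑-mono b (λ j _ → term j) ⟩
    ∑ b (λ j → V * (σ (b ∸ j) * p j) + b * b * e j)
      ≡⟨ ∑-+ b _ _ ⟩
    ∑ b (λ j → V * (σ (b ∸ j) * p j)) + ∑ b (λ j → b * b * e j)
      ≡⟨ cong₂ _+_ (trans (∑-* b V _) (cong (V *_) (sym (ld b (m≤n+m b a))))) (∑-* b (b * b) e) ⟩
    V * (b * p b) + b * b * ∑ b e ∎

-- Comparison of p(a + b) with p(a) p(b)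

from-base : (Q : ℕ → Set) (k : ℕ) → (∀ i → Q (i + k)) → ∀ n → k ≤ n → Q n
from-base Q k h n k≤n = subst Q (m∸n+n≡m k≤n) (h (n ∸ k))

from-base-< : (Q : ℕ → Set) (k s : ℕ) → (∀ {i} → i < s → Q (i + k)) → ∀ n → k ≤ n → n < s + k → Q n
from-base-< Q k s h n k≤n n<s+k = subst Q (m∸n+n≡m k≤n)
  (h (+-cancelʳ-≤ k (suc (n ∸ k)) s (subst (λ v → suc v ≤ s + k) (sym (m∸n+n≡m k≤n)) n<s+k)))

∑-vanish : ∀ k n f → k ≤ n → (∀ j → k ≤ j → j < n → f j ≡ 0) → ∑ n f ≡ ∑ k f
∑-vanish k n f k≤n h = begin
  ∑ n f                              ≡⟨ cong (λ v → ∑ v f) (m+[n∸m]≡n k≤n) ⟨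
  ∑ (k + (n ∸ k)) f                  ≡⟨ ∑-split k (n ∸ k) f ⟩
  ∑ k f + ∑ (n ∸ k) (λ i → f (k + i)) ≡⟨ cong (∑ k f +_) (∑-zero (n ∸ k) (λ i i< → h (k + i) (m≤m+n k i)
                                          (subst (k + i <_) (m+[n∸m]≡n k≤n) (+-monoʳ-< k i<)))) ⟩
  ∑ k f + 0                          ≡⟨ +-identityʳ _ ⟩
  ∑ k f ∎
  where open ≡-Reasoning

-- The case a = 1 of `comparison`: 1 + b ≤ 2b makes the first error at most 20 b², the second is at
-- most E b², and 6 p(b) ≥ 6 M b² absorbs both.
ratio-step : ∀ M E b → 1 ≤ b → E + 20 ≤ 6 * M → M * (b * b) ≤ p b →
  ∑ b (λ j → 5 * p (1 + j) ∸ 6 * p j) ≤ E → 5 * p (1 + b) ≤ 6 * p b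
ratio-step M E b 1≤b E≤ Mb²≤ ∑≤ = comparison 1 b 5 6 (s≤s z≤n) (begin
  5 * ((1 + b) * (1 + b) * ∑ 1 p) + b * b * ∑ b (λ j → 5 * p (1 + j) ∸ 6 * p j)
    ≤⟨ +-mono-≤ (*-monoʳ-≤ 5 (*-mono-≤ (*-mono-≤ 1+b≤2b 1+b≤2b) (≤-reflexive (P-zero 1)))) (*-monoʳ-≤ (b * b) ∑≤) ⟩
  5 * ((b + b) * (b + b) * 1) + b * b * E
    ≡⟨ lem₁ b E ⟩
  (E + 20) * (b * b)
    ≤⟨ *-monoˡ-≤ (b * b) E≤ ⟩
  6 * M * (b * b)
    ≡⟨ *-assoc 6 M (b * b) ⟩
  6 * (M * (b * b))
    ≤⟨ *-monoʳ-≤ 6 (≤-trans Mb²≤ (≤-reflexive (sym (*-identityˡ (p b))))) ⟩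
  6 * (1 * p b) ∎)
  where
  open ≤-Reasoning
  1+b≤2b : 1 + b ≤ b + b
  1+b≤2b = +-monoˡ-≤ b 1≤b
  lem₁ : ∀ b E → 5 * ((b + b) * (b + b) * 1) + b * b * E ≡ (E + 20) * (b * b)
  lem₁ = solve-∀

-- By strong induction all excesses from `k` on vanish, so their sum never exceeds its value `E` at
-- `k`. Growth is used from `c` on, computation between `k` and `c`.
ratio-from : ∀ M E c k → 1 ≤ k → k ≤ c → E + 20 ≤ 6 * M →
  (∀ b → c ≤ b → M * (b * b) ≤ p b) → ∑ k (λ j → 5 * p (1 + j) ∸ 6 * p j) ≤ E →
  (∀ b → k ≤ b → b < c → 5 * p (1 + b) ≤ 6 * p b) → ∀ b → k ≤ b → 5 * p (1 + b) ≤ 6 * p b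
ratio-from M E c k 1≤k k≤c E≤ grow ∑≤ base = <-rec _ go
  where
  go : ∀ b → (∀ {j} → j < b → k ≤ j → 5 * p (1 + j) ≤ 6 * p j) → k ≤ b → 5 * p (1 + b) ≤ 6 * p b
  go b ih k≤b with c ≤? b
  ... | no c≰b  = base b k≤b (≰⇒> c≰b)
  ... | yes c≤b = ratio-step M E b (≤-trans 1≤k k≤b) E≤ (grow b c≤b)
    (subst (_≤ E) (sym (∑-vanish k b _ k≤b (λ j k≤j j<b → m≤n⇒m∸n≡0 (ih j<b k≤j)))) ∑≤)

ratio : ∀ b → 38 ≤ b → 5 * p (1 + b) ≤ 6 * p b
-- 9321 = 9301 + 20 and 6 · 1554 = 9321 + 3.
ratio = ratio-from 1554 9301 76 38 (s≤s z≤n) (m≤m+n 38 38) (m≤m+n 9321 3)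
  (from-base (λ b → 1554 * (b * b) ≤ p b) 76 (growth 1554 76 growing-76)) small-∑
  (from-base-< (λ b → 5 * p (1 + b) ≤ 6 * p b) 38 38 small-ratio)

ratio-^ : ∀ a → 38 ≤ a → ∀ j → p (a + j) * 5 ^ j ≤ 6 ^ j * p a
ratio-^ a 38≤a zero    = ≤-reflexive (trans (*-identityʳ _) (trans (cong p (+-identityʳ a)) (sym (*-identityˡ (p a)))))
ratio-^ a 38≤a (suc j) = begin
  p (a + suc j) * (5 * 5 ^ j)   ≡⟨ cong (λ k → p k * (5 * 5 ^ j)) (+-suc a j) ⟩
  p (1 + (a + j)) * (5 * 5 ^ j) ≡⟨ lem₁ (p (1 + (a + j))) (5 ^ j) ⟩
  5 * p (1 + (a + j)) * 5 ^ j   ≤⟨ *-monoˡ-≤ (5 ^ j) (ratio (a + j) (≤-trans 38≤a (m≤m+n a j))) ⟩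
  6 * p (a + j) * 5 ^ j         ≡⟨ *-assoc 6 (p (a + j)) (5 ^ j) ⟩
  6 * (p (a + j) * 5 ^ j)       ≤⟨ *-monoʳ-≤ 6 (ratio-^ a 38≤a j) ⟩
  6 * (6 ^ j * p a)             ≡⟨ *-assoc 6 (6 ^ j) (p a) ⟨
  6 * 6 ^ j * p a ∎
  where
  open ≤-Reasoning
  lem₁ : ∀ x y → x * (5 * y) ≡ 5 * x * y
  lem₁ = solve-∀

ratio-bound : ∀ a c d j → 38 ≤ a → c * 6 ^ j ≤ d * 5 ^ j → c * p (a + j) ≤ d * p a
ratio-bound a c d j 38≤a h = *-cancelʳ-≤ _ _ (5 ^ j) {{m^n≢0 5 j}} (begin
  c * p (a + j) * 5 ^ j   ≡⟨ *-assoc c (p (a + j)) (5 ^ j) ⟩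
  c * (p (a + j) * 5 ^ j) ≤⟨ *-monoʳ-≤ c (ratio-^ a 38≤a j) ⟩
  c * (6 ^ j * p a)       ≡⟨ *-assoc c (6 ^ j) (p a) ⟨
  c * 6 ^ j * p a         ≤⟨ *-monoˡ-≤ (p a) h ⟩
  d * 5 ^ j * p a         ≡⟨ lem d (5 ^ j) (p a) ⟩
  d * p a * 5 ^ j ∎)
  where
  open ≤-Reasoning
  lem : ∀ x y z → x * y * z ≡ x * z * y
  lem = solve-∀

-- With a + b ≤ 2b and monotonicity of `p`, the first error is at most 13 · 4 = 52 times a b² p(a),
-- and the second at most M times it; this is the origin of `M + 52`.
product-step : ∀ M D a b → a ≤ b → D ≤ M * a → (M + 52) * (b * b) ≤ p b →
  ∑ b (λ j → 13 * p (a + j) ∸ p a * p j) ≤ D * p a → 0 < a → 13 * p (a + b) ≤ p a * p b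
product-step M D a b a≤b D≤ M≤ ∑≤ 0<a = comparison a b 13 (p a) (≤-trans 0<a (m≤m+n a b)) (begin
  13 * ((a + b) * (a + b) * ∑ a p) + b * b * ∑ b (λ j → 13 * p (a + j) ∸ p a * p j)
    ≤⟨ +-mono-≤ (*-monoʳ-≤ 13 (*-mono-≤ (*-mono-≤ a+b≤2b a+b≤2b)
         (≤-trans (∑-mono a (λ j j<a → p-mono (<⇒≤ j<a))) (≤-reflexive (∑-const a (p a))))))
         (*-monoʳ-≤ (b * b) (≤-trans ∑≤ (*-monoˡ-≤ (p a) D≤))) ⟩
  13 * ((b + b) * (b + b) * (a * p a)) + b * b * (M * a * p a)
    ≡⟨ lem M a b (p a) ⟩
  p a * (a * ((M + 52) * (b * b)))
    ≤⟨ *-monoʳ-≤ (p a) (*-monoʳ-≤ a M≤) ⟩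
  p a * (a * p b) ∎)
  where
  open ≤-Reasoning
  a+b≤2b : a + b ≤ b + b
  a+b≤2b = +-monoˡ-≤ b a≤b
  lem : ∀ M a b q → 13 * ((b + b) * (b + b) * (a * q)) + b * b * (M * a * q) ≡ q * (a * ((M + 52) * (b * b)))
  lem = solve-∀

product-bound : ∀ a b → 60 ≤ a → 60 ≤ b → 13 * p (a + b) ≤ p a * p b
product-bound a b = <-rec Q go (a + b) a b refl
  where
  Q : ℕ → Set
  Q n = ∀ a b → a + b ≡ n → 60 ≤ a → 60 ≤ b → 13 * p (a + b) ≤ p a * p b
  module _ (n : ℕ) (ih : ∀ {k} → k < n → Q k) where
    ordered : ∀ a b → a + b ≡ n → 60 ≤ a → a ≤ b → 13 * p (a + b) ≤ p a * p b
    -- 69 is the least M with 60 M ≥ 4097, as 69 · 60 = 4097 + 43.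
    ordered a b eq 60≤a a≤b = product-step 69 4097 a b a≤b
        (≤-trans (m≤m+n 4097 43) (*-monoʳ-≤ 69 60≤a))
        (from-base (λ n → 121 * (n * n) ≤ p n) 60 (growth 121 60 growing-60) b 60≤b)
        ∑≤ (≤-trans (s≤s z≤n) 60≤a)
      where
      60≤b = ≤-trans 60≤a a≤b
      38≤a = ≤-trans (m≤m+n 38 22) 60≤a
      e : ℕ → ℕ
      e j = 13 * p (a + j) ∸ p a * p j
      -- From 60 on the induction hypothesis applies, since a + j < a + b. For 17 ≤ j < 60, p(a + j)
      -- ≤ (6/5)^j p(a) combines with 13 (6/5)^j ≤ p(j).
      vanish : ∀ j → 17 ≤ j → j < b → e j ≡ 0
      vanish j 17≤j j<b with 60 ≤? j
      ... | yes 60≤j = m≤n⇒m∸n≡0 (ih (subst (a + j <_) eq (+-monoʳ-< a j<b)) a j refl 60≤a 60≤j)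
      ... | no 60≰j  = m≤n⇒m∸n≡0 (≤-trans
        (ratio-bound a 13 (p j) j 38≤a (from-base-< (λ j → 13 * 6 ^ j ≤ p j * 5 ^ j) 17 43 small-power j 17≤j (≰⇒> 60≰j)))
        (≤-reflexive (*-comm (p j) (p a))))
      -- 241 is 13 (6/5)^16 rounded up, and 4097 = 17 · 241.
      low : ∀ {j} → j < 17 → 13 * 6 ^ j ≤ 241 * 5 ^ j
      low = toWitness {a? = allUpTo? (λ j → 13 * 6 ^ j ≤? 241 * 5 ^ j) 17} _
      ∑≤ : ∑ b e ≤ 4097 * p a
      ∑≤ = begin
        ∑ b e                        ≡⟨ ∑-vanish 17 b e (≤-trans (m≤m+n 17 43) 60≤b) vanish ⟩
        ∑ 17 e                       ≤⟨ ∑-mono 17 (λ j j<17 → ≤-trans (m∸n≤m (13 * p (a + j)) (p a * p j)) (ratio-bound a 13 241 j 38≤a (low j<17))) ⟩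
        ∑ 17 (λ _ → 241 * p a)       ≡⟨ ∑-const 17 (241 * p a) ⟩
        17 * (241 * p a)             ≡⟨ *-assoc 17 241 (p a) ⟨
        17 * 241 * p a               ≡⟨ cong (_* p a) {17 * 241} {4097} refl ⟩
        4097 * p a                   ∎
        where open ≤-Reasoning
    go : Q n
    go a b eq 60≤a 60≤b with ≤-total a b
    ... | inj₁ a≤b = ordered a b eq 60≤a a≤b
    ... | inj₂ b≤a = subst₂ _≤_ (cong (λ k → 13 * p k) (+-comm b a)) (*-comm (p b) (p a))
                       (ordered b a (trans (+-comm b a) eq) 60≤b b≤a)

-- The product inequality for the two classes

p≤4X : ∀ π n → 5 ≤ n → p n ≤ 4 * X π n
p≤4X π = from-base (λ n → p n ≤ 4 * X π n) 5 (quarter π (base π))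
  where
  base : ∀ π {n} → n < 4 → p (n + 5) ≤ 4 * X π (n + 5)
  base false = small-even .proj₂ .proj₂
  base true  = small-odd .proj₂ .proj₂

-- The opposite class already takes a quarter of all partitions.
4X≤3p : ∀ π n → 5 ≤ n → 4 * X π n ≤ 3 * p n
4X≤3p π n 5≤n = +-cancelʳ-≤ (p n) _ _ (begin
  4 * X π n + p n               ≤⟨ +-monoʳ-≤ (4 * X π n) (p≤4X (not π) n 5≤n) ⟩
  4 * X π n + 4 * X (not π) n   ≡⟨ *-distribˡ-+ 4 (X π n) (X (not π) n) ⟨
  4 * (X π n + X (not π) n)     ≡⟨ cong (4 *_) (P-split π 1 n) ⟨
  4 * p n                       ≡⟨ lem (p n) ⟩
  3 * p n + p n ∎)
  where
  open ≤-Reasoning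
  lem : ∀ x → 4 * x ≡ 3 * x + x
  lem = solve-∀

-- The bounds of 3/4 and 1/4 cost a factor 12; the 13 in `product-bound` supplies strictness.
X-product-large : ∀ π a b → 60 ≤ a → 60 ≤ b → X π (a + b) < X π a * X π b
X-product-large π a b 60≤a 60≤b = *-cancelˡ-< 16 _ _ (begin-strict
  16 * X π (a + b)              ≡⟨ *-assoc 4 4 (X π (a + b)) ⟩
  4 * (4 * X π (a + b))         ≤⟨ *-monoʳ-≤ 4 (4X≤3p π (a + b) (≤-trans 5≤a (m≤m+n a b))) ⟩
  4 * (3 * p (a + b))           ≡⟨ *-assoc 4 3 (p (a + b)) ⟨
  12 * p (a + b)                <⟨ m<n+m (12 * p (a + b)) p>0 ⟩
  13 * p (a + b)                ≤⟨ product-bound a b 60≤a 60≤b ⟩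
  p a * p b                     ≤⟨ *-mono-≤ (p≤4X π a 5≤a) (p≤4X π b 5≤b) ⟩
  4 * X π a * (4 * X π b)       ≡⟨ lem (X π a) (X π b) ⟩
  16 * (X π a * X π b) ∎)
  where
  open ≤-Reasoning
  5≤a = ≤-trans (m≤m+n 5 55) 60≤a
  5≤b = ≤-trans (m≤m+n 5 55) 60≤b
  p>0 : 0 < p (a + b)
  p>0 = subst (_≤ p (a + b)) (P-zero 1) (p-mono z≤n)
  lem : ∀ x y → 4 * x * (4 * y) ≡ 16 * (x * y)
  lem = solve-∀

-- Here p(a + b) ≤ (6/5)^a p(b), so the 3/4 and 1/4 bounds reduce the claim to 3 (6/5)^a < X(a).
X-product-mixed : ∀ π a b → 3 * 6 ^ a < 5 ^ a * X π a → 60 ≤ b → X π (a + b) < X π a * X π b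
X-product-mixed π a b h 60≤b = *-cancelˡ-< (5 ^ a * 4) _ _ (begin-strict
  5 ^ a * 4 * X π (a + b)         ≡⟨ *-assoc (5 ^ a) 4 _ ⟩
  5 ^ a * (4 * X π (a + b))       ≤⟨ *-monoʳ-≤ (5 ^ a) (4X≤3p π (a + b) (≤-trans 5≤b (m≤n+m b a))) ⟩
  5 ^ a * (3 * p (a + b))         ≡⟨ cong (λ k → 5 ^ a * (3 * p k)) (+-comm a b) ⟩
  5 ^ a * (3 * p (b + a))         ≡⟨ lem₁ (5 ^ a) (p (b + a)) ⟩
  3 * (p (b + a) * 5 ^ a)         ≤⟨ *-monoʳ-≤ 3 (ratio-^ b (≤-trans (m≤m+n 38 22) 60≤b) a) ⟩
  3 * (6 ^ a * p b)               ≡⟨ *-assoc 3 (6 ^ a) (p b) ⟨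
  3 * 6 ^ a * p b                 <⟨ *-monoˡ-< (p b) {{>-nonZero p>0}} h ⟩
  5 ^ a * X π a * p b             ≤⟨ *-monoʳ-≤ (5 ^ a * X π a) (p≤4X π b 5≤b) ⟩
  5 ^ a * X π a * (4 * X π b)     ≡⟨ lem₂ (5 ^ a) (X π a) (X π b) ⟩
  5 ^ a * 4 * (X π a * X π b) ∎)
  where
  open ≤-Reasoning
  5≤b = ≤-trans (m≤m+n 5 55) 60≤b
  p>0 : 0 < p b
  p>0 = subst (_≤ p b) (P-zero 1) (p-mono z≤n)
  lem₁ : ∀ x y → x * (3 * y) ≡ 3 * (y * x)
  lem₁ = solve-∀
  lem₂ : ∀ x y z → x * y * (4 * z) ≡ x * 4 * (y * z)
  lem₂ = solve-∀

X-product : ∀ π k c → k + c ≡ 60 → SmallCases X π k c →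
            ∀ a b → c ≤ a → c ≤ b → X π (a + b) < X π a * X π b
X-product π k c k+c≡60 (pairs , powers , _) a b c≤a c≤b = go (60 ≤? a) (60 ≤? b)
  where
  small-range : (Q : ℕ → Set) → (∀ {i} → i < k → Q (i + c)) → ∀ n → c ≤ n → n < 60 → Q n
  small-range Q h n c≤n n<60 = from-base-< Q c k h n c≤n (subst (n <_) (sym k+c≡60) n<60)
  power : ∀ n → c ≤ n → n < 60 → 3 * 6 ^ n < 5 ^ n * X π n
  power = small-range (λ n → 3 * 6 ^ n < 5 ^ n * X π n) powers
  lem : ∀ i j c → i + j + (c + c) ≡ i + c + (j + c)
  lem = solve-∀
  go : Dec (60 ≤ a) → Dec (60 ≤ b) → X π (a + b) < X π a * X π b
  go (yes 60≤a) (yes 60≤b) = X-product-large π a b 60≤a 60≤b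
  go (no  60≰a) (yes 60≤b) = X-product-mixed π a b (power a c≤a (≰⇒> 60≰a)) 60≤b
  go (yes 60≤a) (no  60≰b) = subst₂ _<_ (cong (X π) (+-comm b a)) (*-comm (X π b) (X π a))
    (X-product-mixed π b a (power b c≤b (≰⇒> 60≰b)) 60≤a)
  go (no  60≰a) (no  60≰b) =
    small-range (λ a → X π (a + b) < X π a * X π b) (λ {i} i<k →
      small-range (λ b → X π ((i + c) + b) < X π (i + c) * X π b) (λ {j} j<k →
        subst (λ n → X π n < X π (i + c) * X π (j + c)) (lem i j c) (pairs i<k j<k))
      b c≤b (≰⇒> 60≰b))
    a c≤a (≰⇒> 60≰a)

N2-product : ∀ r k c → 1 ≤ c → k + c ≡ 60 → SmallCases X (odd r) k c →
             ∀ a b → c ≤ a → c ≤ b → N2 r (a + b) < N2 r a * N2 r b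
N2-product r k c 1≤c k+c≡60 h a b c≤a c≤b = subst₂ _<_
  (sym (N2≡G r (a + b) (≤-trans 1≤a (m≤m+n a b))))
  (cong₂ _*_ (sym (N2≡G r a 1≤a)) (sym (N2≡G r b (≤-trans 1≤c c≤b))))
  (X-product (odd r) k c k+c≡60 h a b c≤a c≤b)
  where
  1≤a = ≤-trans 1≤c c≤a

theorem1p3 : ((a b : ℕ) → 11 ≤ a → 11 ≤ b → N2 0 (a + b) < N2 0 a * N2 0 b)
    × ((a b : ℕ) → 12 ≤ a → 12 ≤ b → N2 1 (a + b) < N2 1 a * N2 1 b)
theorem1p3 = N2-product 0 49 11 (s≤s z≤n) refl small-even , N2-product 1 48 12 (s≤s z≤n) refl small-odd
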